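{- Let $\mathcal{Q}$ be a unital quantale, $\phi:\mathbb{A}\nrightarrow\mathbb{B}$ a $\mathcal{Q}$-distributor between $\mathcal{Q}$-categories and $\mathbb{X}$ a separated complete $\mathcal{Q}$-category. (1) $\mathbb{X}$ is isomorphic to $\mathsf{M}\phi$ if, and only if, there exist a $\bigvee$-dense map $F:\mathbb{A}_0\times\mathcal{Q}\to\mathbb{X}_0$ and a $\bigwedge$-dense map $G:\mathbb{B}_0\times\mathcal{Q}\to\mathbb{X}_0$ such that $v\searrow(\phi(a,b)\swarrow u)=\mathbb{X}(F(a,u),G(b,v))$ for all $a\in\mathbb{A}_0$, $b\in\mathbb{B}_0$, $u,v\in\mathcal{Q}$. (2) $\mathbb{X}$ is isomorphic to $\mathsf{K}\phi$ if, and only if, there exist a $\bigvee$-dense map $F:\mathbb{B}_0\times\mathcal{Q}\to\mathbb{X}_0$ and a $\bigwedge$-dense map $G:\mathbb{A}_0\times\mathcal{Q}\to\mathbb{X}_0$ such that $(u\swarrow\phi(a,b))\swarrow v=\mathbb{X}(F(b,v),G(a,u))$ for all $a\in\mathbb{A}_0$, $b\in\mathbb{B}_0$, $u,v\in\mathcal{Q}$.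
   Context: A unital quantale $\mathcal{Q}$ is a complete lattice with a monoid structure $(\circ,1)$ (not necessarily commutative) such that $\circ$ preserves arbitrary joins in each variable. The implications are determined by $v\circ u\leq w\iff v\leq w\swarrow u\iff u\leq v\searrow w$. A $\mathcal{Q}$-category $\mathbb{A}$ is a set $\mathbb{A}_0$ with elements $\mathbb{A}(x,y)\in\mathcal{Q}$ such that $1\leq\mathbb{A}(x,x)$ and $\mathbb{A}(y,z)\circ\mathbb{A}(x,y)\leq\mathbb{A}(x,z)$. The underlying preorder is $x\leq y$ iff $1\leq\mathbb{A}(x,y)$; $x\cong y$ means $x\leq y$ and $y\leq x$; $\mathbb{A}$ is separated if $x\cong y$ implies $x=y$. A $\mathcal{Q}$-functor $F:\mathbb{A}\to\mathbb{B}$ is a map $\mathbb{A}_0\to\mathbb{B}_0$ with $\mathbb{A}(x,x')\leq\mathbb{B}(Fx,Fx')$; an isomorphism is a $\mathcal{Q}$-functor with a two-sided inverse $\mathcal{Q}$-functor. A $\mathcal{Q}$-distributor $\phi:\mathbb{A}\nrightarrow\mathbb{B}$ is a map $\phi:\mathbb{A}_0\times\mathbb{B}_0\to\mathcal{Q}$ with $\mathbb{B}(y,y')\circ\phi(x,y)\circ\mathbb{A}(x',x)\leq\phi(x',y')$. $\mathsf{P}\mathbb{A}$ is the $\mathcal{Q}$-category of maps $\mu:\mathbb{A}_0\to\mathcal{Q}$ with $\mu(x)\circ\mathbb{A}(x',x)\leq\mu(x')$, with $\mathsf{P}\mathbb{A}(\mu,\mu')=\bigwedge_{x}\mu'(x)\swarrow\mu(x)$.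 $\mathsf{P}^\dagger\mathbb{B}$ consists of maps $\lambda:\mathbb{B}_0\to\mathcal{Q}$ with $\mathbb{B}(y,y')\circ\lambda(y)\leq\lambda(y')$. $\mathbb{A}$ is complete if for every $\mu\in\mathsf{P}\mathbb{A}$ there is $s\in\mathbb{A}_0$ with $\mathbb{A}(s,y)=\bigwedge_{x}\mathbb{A}(x,y)\swarrow\mu(x)$ for all $y$. For $\phi:\mathbb{A}\nrightarrow\mathbb{B}$, define $\phi_\uparrow:\mathsf{P}\mathbb{A}\to\mathsf{P}^\dagger\mathbb{B}$, $(\phi_\uparrow\mu)(b)=\bigwedge_a\phi(a,b)\swarrow\mu(a)$; $\phi^\downarrow:\mathsf{P}^\dagger\mathbb{B}\to\mathsf{P}\mathbb{A}$, $(\phi^\downarrow\lambda)(a)=\bigwedge_b\lambda(b)\searrow\phi(a,b)$; $\phi^*:\mathsf{P}\mathbb{B}\to\mathsf{P}\mathbb{A}$, $(\phi^*\lambda)(a)=\bigvee_b\lambda(b)\circ\phi(a,b)$; $\phi_*:\mathsf{P}\mathbb{A}\to\mathsf{P}\mathbb{B}$, $(\phi_*\mu)(b)=\bigwedge_a\mu(a)\swarrow\phi(a,b)$. $\mathsf{M}\phi=\{\mu\in\mathsf{P}\mathbb{A}\mid\phi^\downarrow\phi_\uparrow\mu=\mu\}$ and $\mathsf{K}\phi=\{\lambda\in\mathsf{P}\mathbb{B}\mid\phi_*\phi^*\lambda=\lambda\}$, with hom-values inherited from $\mathsf{P}\mathbb{A}$, $\mathsf{P}\mathbb{B}$ respectively.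 A map $F:A\to\mathbb{X}_0$ from a set $A$ is $\bigvee$-dense (resp. $\bigwedge$-dense) if every $y\in\mathbb{X}_0$ satisfies $y\cong\bigvee_{i\in I}Fx_i$ (resp. $y\cong\bigwedge_{i\in I}Fx_i$) in the underlying preorder of $\mathbb{X}$ for some family $\{x_i\}_{i\in I}\subseteq A$ (possibly empty). -}

module Defs where

open import Level using (Level; suc)
open import Data.Product.Base using (Σ; Σ-syntax; _×_; _,_; proj₁; proj₂)
open import Function.Bundles using (Func; _⟨$⟩_)
open import Relation.Binary.Core using (Rel)
open import Relation.Binary.Bundles using (Poset; Setoid)
open import Relation.Binary.Structures using (IsEquivalence)
open import Algebra.Structures using (IsMonoid)
import Relation.Binary.Construct.On as On

-- Sets are setoids over a fixed universe Set ℓ, and families are indexed by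
-- arbitrary types I : Set ℓ of that same universe.  This is what lets one take
-- meets over the objects of 𝖯𝔸, 𝖬φ and 𝖪φ, which are again types in Set ℓ.

module _ {ℓ : Level} {C I : Set ℓ} (_≤_ : Rel C ℓ) where

  IsSup : (I → C) → C → Set ℓ
  IsSup f s = (∀ i → f i ≤ s) × (∀ z → (∀ i → f i ≤ z) → s ≤ z)

  IsInf : (I → C) → C → Set ℓ
  IsInf f s = (∀ i → s ≤ f i) × (∀ z → (∀ i → z ≤ f i) → z ≤ s)

record CompleteLattice (ℓ : Level) : Set (suc ℓ) where
  field
    poset : Poset ℓ ℓ ℓ
  open Poset poset public
  field
    ⋁     : {I : Set ℓ} → (I → Carrier) → Carrier
    ⋀     : {I : Set ℓ} → (I → Carrier) → Carrier
    ⋁-sup : {I : Set ℓ} (f : I → Carrier) → IsSup _≤_ f (⋁ f)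
    ⋀-inf : {I : Set ℓ} (f : I → Carrier) → IsInf _≤_ f (⋀ f)

  ⋁-upper : {I : Set ℓ} (f : I → Carrier) (i : I) → f i ≤ ⋁ f
  ⋁-upper f = proj₁ (⋁-sup f)

  ⋁-least : {I : Set ℓ} (f : I → Carrier) {z : Carrier} →
            (∀ i → f i ≤ z) → ⋁ f ≤ z
  ⋁-least f = proj₂ (⋁-sup f) _

  ⋀-lower : {I : Set ℓ} (f : I → Carrier) (i : I) → ⋀ f ≤ f i
  ⋀-lower f = proj₁ (⋀-inf f)

  ⋀-greatest : {I : Set ℓ} (f : I → Carrier) {z : Carrier} →
               (∀ i → z ≤ f i) → z ≤ ⋀ f
  ⋀-greatest f = proj₂ (⋀-inf f) _

record Quantale (ℓ : Level) : Set (suc ℓ) where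
  field
    completeLattice : CompleteLattice ℓ
  open CompleteLattice completeLattice public
  infixr 8 _∘_
  field
    _∘_      : Carrier → Carrier → Carrier
    𝟏        : Carrier
    isMonoid : IsMonoid _≈_ _∘_ 𝟏
    ⋁-∘      : {I : Set ℓ} (f : I → Carrier) (u : Carrier) →
               (⋁ f ∘ u) ≈ ⋁ (λ i → f i ∘ u)
    ∘-⋁      : {I : Set ℓ} (v : Carrier) (f : I → Carrier) →
               (v ∘ ⋁ f) ≈ ⋁ (λ i → v ∘ f i)

  open IsMonoid isMonoid public
    using (assoc; identityˡ; identityʳ; ∙-cong)

  setoid : Setoid ℓ ℓ
  setoid = Poset.Eq.setoid poset

  -- The implications are the residuals of ∘, which exist because ∘ preserves
  -- joins in each variable.
  infixl 7 _↙_
  infixr 7 _↘_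

  _↙_ : Carrier → Carrier → Carrier
  w ↙ u = ⋁ {I = Σ[ v ∈ Carrier ] (v ∘ u) ≤ w} proj₁

  _↘_ : Carrier → Carrier → Carrier
  v ↘ w = ⋁ {I = Σ[ u ∈ Carrier ] (v ∘ u) ≤ w} proj₁

  ∘-monoˡ : ∀ {v v′} u → v ≤ v′ → (v ∘ u) ≤ (v′ ∘ u)
  ∘-monoˡ {v} {v′} u v≤v′ = trans
    (trans (⋁-upper {Σ[ x ∈ Carrier ] x ≤ v′} (λ i → proj₁ i ∘ u) (v , v≤v′))
           (reflexive (Eq.sym (⋁-∘ proj₁ u))))
    (reflexive (∙-cong (antisym (⋁-least proj₁ proj₂) (⋁-upper proj₁ (v′ , refl)))
                       Eq.refl))

  ∘-monoʳ : ∀ v {u u′} → u ≤ u′ → (v ∘ u) ≤ (v ∘ u′)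
  ∘-monoʳ v {u} {u′} u≤u′ = trans
    (trans (⋁-upper {Σ[ x ∈ Carrier ] x ≤ u′} (λ i → v ∘ proj₁ i) (u , u≤u′))
           (reflexive (Eq.sym (∘-⋁ v proj₁))))
    (reflexive (∙-cong Eq.refl
                       (antisym (⋁-least proj₁ proj₂) (⋁-upper proj₁ (u′ , refl)))))

  ↙-eval : ∀ w u → ((w ↙ u) ∘ u) ≤ w
  ↙-eval w u = trans (reflexive (⋁-∘ proj₁ u)) (⋁-least _ proj₂)

  ↘-eval : ∀ v w → (v ∘ (v ↘ w)) ≤ w
  ↘-eval v w = trans (reflexive (∘-⋁ v proj₁)) (⋁-least _ proj₂)

  ↙-intro : ∀ {v u w} → (v ∘ u) ≤ w → v ≤ w ↙ u
  ↙-intro {v} p = ⋁-upper proj₁ (v , p)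

  ↙-elim : ∀ {v u w} → v ≤ w ↙ u → (v ∘ u) ≤ w
  ↙-elim {v} {u} {w} p = trans (∘-monoˡ u p) (↙-eval w u)

  ↘-intro : ∀ {v u w} → (v ∘ u) ≤ w → u ≤ v ↘ w
  ↘-intro {u = u} p = ⋁-upper proj₁ (u , p)

  ↘-elim : ∀ {v u w} → u ≤ v ↘ w → (v ∘ u) ≤ w
  ↘-elim {v} {u} {w} p = trans (∘-monoʳ v p) (↘-eval v w)

  ↙-mono : ∀ {w w′ u u′} → w ≤ w′ → u′ ≤ u → w ↙ u ≤ w′ ↙ u′
  ↙-mono {w} {w′} {u} w≤w′ u′≤u =
    ↙-intro (trans (∘-monoʳ (w ↙ u) u′≤u) (trans (↙-eval w u) w≤w′))

  assoc≤ : ∀ x y z → ((x ∘ y) ∘ z) ≤ (x ∘ (y ∘ z))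
  assoc≤ x y z = reflexive (assoc x y z)

  assoc≥ : ∀ x y z → (x ∘ (y ∘ z)) ≤ ((x ∘ y) ∘ z)
  assoc≥ x y z = reflexive (Eq.sym (assoc x y z))

module _ {ℓ : Level} (𝓠 : Quantale ℓ) where
  open Quantale 𝓠

  record QCategory : Set (suc ℓ) where
    field
      objects : Setoid ℓ ℓ
    Obj : Set ℓ
    Obj = Setoid.Carrier objects
    field
      hom      : Obj → Obj → Carrier
      hom-cong : ∀ {x x′ y y′} → Setoid._≈_ objects x x′ →
                 Setoid._≈_ objects y y′ → hom x y ≈ hom x′ y′
      unit     : ∀ x → 𝟏 ≤ hom x x
      comp     : ∀ x y z → (hom y z ∘ hom x y) ≤ hom x z

    infix 4 _⊑_ _≅_

    _⊑_ : Rel Obj ℓ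
    x ⊑ y = 𝟏 ≤ hom x y

    _≅_ : Rel Obj ℓ
    x ≅ y = x ⊑ y × y ⊑ x

module _ {ℓ : Level} {𝓠 : Quantale ℓ} where
  open Quantale 𝓠
  open QCategory using (objects; Obj; hom; hom-cong; unit; comp)

  Separated : QCategory 𝓠 → Set ℓ
  Separated 𝔸 = ∀ {x y} → x ≅ y → Setoid._≈_ objs x y
    where open QCategory 𝔸 using (_≅_) renaming (objects to objs)

  record QFunctor (𝔸 𝔹 : QCategory 𝓠) : Set ℓ where
    field
      func : Func (objects 𝔸) (objects 𝔹)
      mono : ∀ x x′ → hom 𝔸 x x′ ≤ hom 𝔹 (func ⟨$⟩ x) (func ⟨$⟩ x′)

  record Isomorphic (𝔸 𝔹 : QCategory 𝓠) : Set ℓ where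
    field
      to   : QFunctor 𝔸 𝔹
      from : QFunctor 𝔹 𝔸
    open QFunctor to   using () renaming (func to F)
    open QFunctor from using () renaming (func to G)
    field
      from-to : ∀ x → Setoid._≈_ (objects 𝔸) (G ⟨$⟩ (F ⟨$⟩ x)) x
      to-from : ∀ y → Setoid._≈_ (objects 𝔹) (F ⟨$⟩ (G ⟨$⟩ y)) y

  -- For distributors, presheaves and copresheaves, compatibility with the
  -- setoid equalities is not a field: it follows from the action inequality,
  -- since x ≈ x′ implies 𝟏 ≤ 𝔸(x′,x) and 𝟏 ≤ 𝔸(x,x′).

  record QDistributor (𝔸 𝔹 : QCategory 𝓠) : Set ℓ where
    field
      at     : Obj 𝔸 → Obj 𝔹 → Carrier
      action : ∀ x x′ y y′ →
               (hom 𝔹 y y′ ∘ at x y ∘ hom 𝔸 x′ x) ≤ at x′ y′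

    actionˡ : ∀ x y y′ → (hom 𝔹 y y′ ∘ at x y) ≤ at x y′
    actionˡ x y y′ = trans
      (∘-monoʳ (hom 𝔹 y y′)
        (trans (reflexive (Eq.sym (identityʳ _))) (∘-monoʳ (at x y) (unit 𝔸 x))))
      (action x x y y′)

    actionʳ : ∀ x x′ y → (at x y ∘ hom 𝔸 x′ x) ≤ at x′ y
    actionʳ x x′ y = trans
      (trans (reflexive (Eq.sym (identityˡ _))) (∘-monoˡ _ (unit 𝔹 y)))
      (action x x′ y y)

  record Presheaf (𝔸 : QCategory 𝓠) : Set ℓ where
    field
      at     : Obj 𝔸 → Carrier
      action : ∀ x x′ → (at x ∘ hom 𝔸 x′ x) ≤ at x′

  record Copresheaf (𝔹 : QCategory 𝓠) : Set ℓ where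
    field
      at     : Obj 𝔹 → Carrier
      action : ∀ y y′ → (hom 𝔹 y y′ ∘ at y) ≤ at y′

  open QDistributor using (actionˡ; actionʳ) renaming (at to infix 10 _⟪_,_⟫)
  open Presheaf     using (action) renaming (at to infix 10 _⟨_⟩)
  open Copresheaf   using () renaming (at to infix 10 _⟨_⟩†; action to action†)

  𝖯 : QCategory 𝓠 → QCategory 𝓠
  𝖯 𝔸 = record
    { objects  = record
      { Carrier       = Presheaf 𝔸
      ; _≈_           = λ μ ν → ∀ x → μ ⟨ x ⟩ ≈ ν ⟨ x ⟩
      ; isEquivalence = record
        { refl  = λ x → Eq.refl
        ; sym   = λ p x → Eq.sym (p x)
        ; trans = λ p q x → Eq.trans (p x) (q x)
        }
      }
    ; hom      = homᴾ
    ; hom-cong = λ {μ} {μ′} {ν} {ν′} p q → antisym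
        (homᴾ-mono μ μ′ ν ν′
          (λ x → reflexive (Eq.sym (p x))) (λ x → reflexive (q x)))
        (homᴾ-mono μ′ μ ν′ ν
          (λ x → reflexive (p x)) (λ x → reflexive (Eq.sym (q x))))
    ; unit     = λ μ → ⋀-greatest _ λ x → ↙-intro (reflexive (identityˡ _))
    ; comp     = λ μ ν κ → ⋀-greatest _ λ x → ↙-intro
        (trans (assoc≤ _ _ _)
        (trans (∘-monoʳ _ (↙-elim (⋀-lower _ x)))
               (↙-elim (⋀-lower _ x))))
    }
    where
    homᴾ : Presheaf 𝔸 → Presheaf 𝔸 → Carrier
    homᴾ μ ν = ⋀ λ x → ν ⟨ x ⟩ ↙ μ ⟨ x ⟩

    homᴾ-mono : ∀ μ μ′ ν ν′ → (∀ x → μ′ ⟨ x ⟩ ≤ μ ⟨ x ⟩) →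
                (∀ x → ν ⟨ x ⟩ ≤ ν′ ⟨ x ⟩) → homᴾ μ ν ≤ homᴾ μ′ ν′
    homᴾ-mono μ μ′ ν ν′ p q = ⋀-greatest _ λ x → trans (⋀-lower _ x) (↙-mono (q x) (p x))

  Complete : QCategory 𝓠 → Set ℓ
  Complete 𝔸 = (μ : Presheaf 𝔸) →
    Σ[ s ∈ Obj 𝔸 ] ∀ y → hom 𝔸 s y ≈ ⋀ λ x → hom 𝔸 x y ↙ μ ⟨ x ⟩

  FullSub : (𝔸 : QCategory 𝓠) → (Obj 𝔸 → Set ℓ) → QCategory 𝓠
  FullSub 𝔸 P = record
    { objects  = On.setoid {B = Σ (Obj 𝔸) P} (objects 𝔸) proj₁
    ; hom      = λ x y → hom 𝔸 (proj₁ x) (proj₁ y)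
    ; hom-cong = hom-cong 𝔸
    ; unit     = λ x → unit 𝔸 (proj₁ x)
    ; comp     = λ x y z → comp 𝔸 (proj₁ x) (proj₁ y) (proj₁ z)
    }

  module _ {𝔸 𝔹 : QCategory 𝓠} where

    infixr 9 _↑_ _↓_ _^*_ _⁎_

    _↑_ : QDistributor 𝔸 𝔹 → Presheaf 𝔸 → Copresheaf 𝔹
    φ ↑ μ = record
      { at     = λ b → ⋀ λ a → φ ⟪ a , b ⟫ ↙ μ ⟨ a ⟩
      ; action = λ b b′ → ⋀-greatest _ λ a → ↙-intro
          (trans (assoc≤ _ _ _)
          (trans (∘-monoʳ _ (↙-elim (⋀-lower _ a))) (actionˡ φ a b b′)))
      }

    _↓_ : QDistributor 𝔸 𝔹 → Copresheaf 𝔹 → Presheaf 𝔸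
    φ ↓ κ = record
      { at     = λ a → ⋀ λ b → κ ⟨ b ⟩† ↘ φ ⟪ a , b ⟫
      ; action = λ a a′ → ⋀-greatest _ λ b → ↘-intro
          (trans (assoc≥ _ _ _)
          (trans (∘-monoˡ _ (↘-elim (⋀-lower _ b))) (actionʳ φ a a′ b)))
      }

    _^*_ : QDistributor 𝔸 𝔹 → Presheaf 𝔹 → Presheaf 𝔸
    φ ^* ν = record
      { at     = λ a → ⋁ λ b → ν ⟨ b ⟩ ∘ φ ⟪ a , b ⟫
      ; action = λ a a′ → trans (reflexive (⋁-∘ _ _)) (⋁-least _ λ b →
          trans (assoc≤ _ _ _)
          (trans (∘-monoʳ _ (actionʳ φ a a′ b)) (⋁-upper _ b)))
      }

    _⁎_ : QDistributor 𝔸 𝔹 → Presheaf 𝔸 → Presheaf 𝔹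
    φ ⁎ μ = record
      { at     = λ b → ⋀ λ a → μ ⟨ a ⟩ ↙ φ ⟪ a , b ⟫
      ; action = λ b b′ → ⋀-greatest _ λ a → ↙-intro
          (trans (assoc≤ _ _ _)
          (trans (∘-monoʳ _ (actionˡ φ a b′ b)) (↙-elim (⋀-lower _ a))))
      }

    𝖬 : QDistributor 𝔸 𝔹 → QCategory 𝓠
    𝖬 φ = FullSub (𝖯 𝔸) λ μ → Setoid._≈_ (objects (𝖯 𝔸)) (φ ↓ φ ↑ μ) μ

    𝖪 : QDistributor 𝔸 𝔹 → QCategory 𝓠
    𝖪 φ = FullSub (𝖯 𝔹) λ ν → Setoid._≈_ (objects (𝖯 𝔹)) (φ ⁎ φ ^* ν) ν

  module _ {S : Setoid ℓ ℓ} (𝕏 : QCategory 𝓠) (F : Func S (objects 𝕏)) where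
    open QCategory 𝕏 using (_⊑_)

    -- y ≅ ⋁ᵢ F xᵢ in the underlying preorder says exactly that y is a
    -- supremum of the family, suprema in a preorder being unique up to ≅.

    ⋁-Dense : Set (suc ℓ)
    ⋁-Dense = ∀ y → Σ[ I ∈ Set ℓ ] Σ[ x ∈ (I → Setoid.Carrier S) ]
                IsSup _⊑_ (λ i → F ⟨$⟩ x i) y

    ⋀-Dense : Set (suc ℓ)
    ⋀-Dense = ∀ y → Σ[ I ∈ Set ℓ ] Σ[ x ∈ (I → Setoid.Carrier S) ]
                IsInf _⊑_ (λ i → F ⟨$⟩ x i) y

{-# OPTIONS --safe #-}
module Submission where

-- Both equivalences are instances of one representation theorem.  Let 𝕏 and 𝕐
-- be separated and complete, and let F′ : S → 𝕐 be ⋁-dense and G′ : T → 𝕐 be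
-- ⋀-dense.  Then 𝕏 ≅ 𝕐 iff there are a ⋁-dense F : S → 𝕏 and a ⋀-dense
-- G : T → 𝕏 with 𝕏(F s, G t) = 𝕐(F′ s, G′ t) (`representation`).
--
-- One direction transports F′ and G′ along the isomorphism.  For the other,
-- completeness makes suprema and infima of the underlying preorder enriched:
-- 𝕏(⋁ fᵢ, y) = ⋀ 𝕏(fᵢ, y) and dually (`sup-conical`, `inf-conical`).  Writing
-- x as ⋁ F sᵢ and putting Φ x = ⋁ F′ sᵢ gives 𝕐(Φ x, G′ t) = 𝕏(x, G t) for
-- all t.  As an object is determined by the homs into a ⋀-dense family, this
-- makes Φ a functor, and the functor built in the same way from 𝕐 to 𝕏 is its
-- inverse.
--
-- It remains to exhibit 𝖬φ and 𝖪φ as such 𝕐.  Each consists of the fixed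
-- points of a closure operator on presheaves, φ↓φ↑ and φ⁎φ^* respectively, so
-- each is reflective in a presheaf category and hence complete.  The closures
-- of the copowers u ∘ 𝔸(-, a) of representables are ⋁-dense in the fixed points
-- of any closure operator (`generator-dense`), and homs out of them are given
-- by the Yoneda lemma.  The ⋀-dense families are a ↦ v ↘ φ(a,b) for 𝖬φ and
-- b ↦ u ↙ φ(a,b) for 𝖪φ.

open import Defs
open import Level using (Level; suc)
open import Data.Product.Base using (Σ-syntax; _×_; _,_; proj₁; proj₂)
open import Data.Product.Relation.Binary.Pointwise.NonDependent using (_×ₛ_)
open import Function.Base using (_$_)
open import Function.Bundles using (Func; _⟨$⟩_; _⇔_; mk⇔; Equivalence)
open import Relation.Binary.Bundles using (Setoid)

module _ {ℓ : Level} {𝓠 : Quantale ℓ} where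
  open Quantale 𝓠
  open QCategory using (objects; Obj; hom; hom-cong; unit; comp)
  open QDistributor using (actionˡ; actionʳ) renaming (at to infix 10 _⟪_,_⟫)
  open Presheaf using (action) renaming (at to infix 10 _⟨_⟩)

  -- Residuals and meets

  ≈⇒≤ : ∀ {x y} → x ≈ y → x ≤ y
  ≈⇒≤ = reflexive

  ≈⇒≥ : ∀ {x y} → x ≈ y → y ≤ x
  ≈⇒≥ p = reflexive (Eq.sym p)

  ⋀-cong : {I : Set ℓ} {f g : I → Carrier} → (∀ i → f i ≈ g i) → ⋀ f ≈ ⋀ g
  ⋀-cong p = antisym
    (⋀-greatest _ λ i → trans (⋀-lower _ i) (≈⇒≤ (p i)))
    (⋀-greatest _ λ i → trans (⋀-lower _ i) (≈⇒≥ (p i)))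

  ↙-𝟏 : ∀ w → (w ↙ 𝟏) ≈ w
  ↙-𝟏 w = antisym (trans (≈⇒≥ (identityʳ _)) (↙-eval w 𝟏))
                  (↙-intro (≈⇒≤ (identityʳ w)))

  ↘-mono : ∀ {v v′ w w′} → v′ ≤ v → w ≤ w′ → v ↘ w ≤ v′ ↘ w′
  ↘-mono {v} {v′} {w} v′≤v w≤w′ =
    ↘-intro (trans (∘-monoˡ (v ↘ w) v′≤v) (trans (↘-eval v w) w≤w′))

  ↘-↙-assoc : ∀ v w u → ((v ↘ w) ↙ u) ≈ (v ↘ (w ↙ u))
  ↘-↙-assoc v w u = antisym
    (↘-intro $ ↙-intro $ trans (assoc≤ _ _ _)
      (trans (∘-monoʳ v (↙-eval _ u)) (↘-eval v w)))
    (↙-intro $ ↘-intro $ trans (assoc≥ _ _ _)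
      (trans (∘-monoˡ u (↘-eval v _)) (↙-eval w u)))

  -- Weighted suprema

  -- s is the colimit of the family f weighted by w.
  IsWeightedSup : (𝕏 : QCategory 𝓠) {I : Set ℓ} →
                  (I → Obj 𝕏) → (I → Carrier) → Obj 𝕏 → Set ℓ
  IsWeightedSup 𝕏 f w s = ∀ y → hom 𝕏 s y ≈ ⋀ λ i → hom 𝕏 (f i) y ↙ w i

  HasWeightedSups : QCategory 𝓠 → Set (suc ℓ)
  HasWeightedSups 𝕏 = {I : Set ℓ} (f : I → Obj 𝕏) (w : I → Carrier) →
                      Σ[ s ∈ Obj 𝕏 ] IsWeightedSup 𝕏 f w s

  weighted⇒complete : ∀ 𝕏 → HasWeightedSups 𝕏 → Complete 𝕏
  weighted⇒complete 𝕏 sup μ = sup (λ x → x) (μ ⟨_⟩)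

  module _ (𝕏 : QCategory 𝓠) where
    open QCategory 𝕏 using (_⊑_)

    ⊑-pre : ∀ {x y} z → x ⊑ y → hom 𝕏 y z ≤ hom 𝕏 x z
    ⊑-pre {x} {y} z p =
      trans (≈⇒≥ (identityʳ _)) (trans (∘-monoʳ _ p) (comp 𝕏 x y z))

    ⊑-post : ∀ {y z} x → y ⊑ z → hom 𝕏 x y ≤ hom 𝕏 x z
    ⊑-post {y} {z} x p =
      trans (≈⇒≥ (identityˡ _)) (trans (∘-monoˡ _ p) (comp 𝕏 x y z))

    ≈⇒⊑ : ∀ {x y} → Setoid._≈_ (objects 𝕏) x y → x ⊑ y
    ≈⇒⊑ {x} p = trans (unit 𝕏 x) (≈⇒≤ (hom-cong 𝕏 (Setoid.refl (objects 𝕏)) p))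

    module _ (complete : Complete 𝕏) where

      complete⇒weighted : HasWeightedSups 𝕏
      complete⇒weighted {I} f w = s , λ y → Eq.trans (s-sup y) (antisym
        (⋀-greatest _ λ i → ↙-intro $
          trans (∘-monoʳ _ (weight i)) (↙-elim (⋀-lower _ (f i))))
        (⋀-greatest _ λ x → ↙-intro $
          trans (≈⇒≤ (∘-⋁ _ _)) $ ⋁-least _ λ i →
          trans (assoc≥ _ _ _) $
          trans (∘-monoˡ _ (↙-elim (⋀-lower _ i))) (comp 𝕏 x (f i) y)))
        where
        -- The left Kan extension of the weight along f.
        μ : Presheaf 𝕏
        μ = record
          { at     = λ x → ⋁ λ i → w i ∘ hom 𝕏 x (f i)
          ; action = λ x x′ → trans (≈⇒≤ (⋁-∘ _ _)) $ ⋁-least _ λ i →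
              trans (assoc≤ _ _ _) $
              trans (∘-monoʳ _ (comp 𝕏 x′ x (f i))) (⋁-upper _ i)
          }
        weight : ∀ i → w i ≤ μ ⟨ f i ⟩
        weight i = trans (≈⇒≥ (identityʳ _)) $
          trans (∘-monoʳ (w i) (unit 𝕏 (f i))) (⋁-upper _ i)
        s     = proj₁ (complete μ)
        s-sup = proj₂ (complete μ)

      conical-sup : {I : Set ℓ} (f : I → Obj 𝕏) →
                    Σ[ s ∈ Obj 𝕏 ] ∀ y → hom 𝕏 s y ≈ ⋀ λ i → hom 𝕏 (f i) y
      conical-sup f with complete⇒weighted f (λ _ → 𝟏)
      ... | s , p = s , λ y → Eq.trans (p y) (⋀-cong λ i → ↙-𝟏 _)

      -- An infimum is the supremum of the presheaf of lower bounds.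
      conical-inf : {I : Set ℓ} (f : I → Obj 𝕏) →
                    Σ[ t ∈ Obj 𝕏 ] ∀ z → hom 𝕏 z t ≈ ⋀ λ i → hom 𝕏 z (f i)
      conical-inf {I} f = t , λ z → antisym
        (⋀-greatest _ λ i → ⊑-post z (t-lower i))
        (trans (≈⇒≥ (identityˡ _)) (↙-elim
          (trans (unit 𝕏 t) (trans (≈⇒≤ (t-sup t)) (⋀-lower _ z)))))
        where
        μ : Presheaf 𝕏
        μ = record
          { at     = λ x → ⋀ λ i → hom 𝕏 x (f i)
          ; action = λ x x′ → ⋀-greatest _ λ i →
              trans (∘-monoˡ _ (⋀-lower _ i)) (comp 𝕏 x′ x (f i))
          }
        t     = proj₁ (complete μ)
        t-sup = proj₂ (complete μ)
        t-lower : ∀ i → t ⊑ f i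
        t-lower i = trans (⋀-greatest _ λ x → ↙-intro
            (trans (≈⇒≤ (identityˡ _)) (⋀-lower _ i)))
          (≈⇒≥ (t-sup (f i)))

      sup-conical : {I : Set ℓ} {f : I → Obj 𝕏} {s : Obj 𝕏} → IsSup _⊑_ f s →
                    ∀ y → hom 𝕏 s y ≈ ⋀ λ i → hom 𝕏 (f i) y
      sup-conical {f = f} (upper , least) y = antisym
        (⋀-greatest _ λ i → ⊑-pre y (upper i))
        (trans (≈⇒≥ (c y)) (⊑-pre y (least s′ s′-upper)))
        where
        s′ = proj₁ (conical-sup f)
        c  = proj₂ (conical-sup f)
        s′-upper : ∀ i → f i ⊑ s′
        s′-upper i = trans (unit 𝕏 s′) (trans (≈⇒≤ (c s′)) (⋀-lower _ i))

      inf-conical : {I : Set ℓ} {f : I → Obj 𝕏} {t : Obj 𝕏} → IsInf _⊑_ f t →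
                    ∀ z → hom 𝕏 z t ≈ ⋀ λ i → hom 𝕏 z (f i)
      inf-conical {f = f} (lower , greatest) z = antisym
        (⋀-greatest _ λ i → ⊑-post z (lower i))
        (trans (≈⇒≥ (c z)) (⊑-post z (greatest t′ t′-lower)))
        where
        t′ = proj₁ (conical-inf f)
        c  = proj₂ (conical-inf f)
        t′-lower : ∀ i → t′ ⊑ f i
        t′-lower i = trans (unit 𝕏 t′) (trans (≈⇒≤ (c t′)) (⋀-lower _ i))

    ⋀-dense-⊑ : {T : Setoid ℓ ℓ} (G : Func T (objects 𝕏)) → ⋀-Dense 𝕏 G →
                ∀ {x y} → (∀ t → hom 𝕏 y (G ⟨$⟩ t) ≤ hom 𝕏 x (G ⟨$⟩ t)) → x ⊑ y
    ⋀-dense-⊑ G G-dense {x} {y} p with G-dense y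
    ... | I , t , lower , greatest =
      greatest x λ i → trans (lower i) (p (t i))

  -- The representation theorem

  module _ {S T : Setoid ℓ ℓ} (𝕏 𝕐 : QCategory 𝓠)
           (F : Func S (objects 𝕏)) (G : Func T (objects 𝕏))
           (F′ : Func S (objects 𝕐)) (G′ : Func T (objects 𝕐)) where

    -- (F , G) and (F′ , G′) induce the same S × T-matrix with entries in 𝓠.
    SameHoms : Set ℓ
    SameHoms = ∀ s t → hom 𝕐 (F′ ⟨$⟩ s) (G′ ⟨$⟩ t) ≈ hom 𝕏 (F ⟨$⟩ s) (G ⟨$⟩ t)

    module Comparison (𝕏-complete : Complete 𝕏) (𝕐-separated : Separated 𝕐)
                      (𝕐-complete : Complete 𝕐) (F-dense : ⋁-Dense 𝕏 F)
                      (G′-dense : ⋀-Dense 𝕐 G′) (same : SameHoms) where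

      private
        sup′ : (x : Obj 𝕏) → Σ[ s ∈ Obj 𝕐 ] ∀ y →
               hom 𝕐 s y ≈ ⋀ λ i → hom 𝕐 (F′ ⟨$⟩ proj₁ (proj₂ (F-dense x)) i) y
        sup′ x = conical-sup 𝕐 𝕐-complete _

      -- If x is the supremum of the F sᵢ, then Φ x is that of the F′ sᵢ.
      Φ : Obj 𝕏 → Obj 𝕐
      Φ x = proj₁ (sup′ x)

      Φ-hom : ∀ x t → hom 𝕐 (Φ x) (G′ ⟨$⟩ t) ≈ hom 𝕏 x (G ⟨$⟩ t)
      Φ-hom x t = Eq.trans (proj₂ (sup′ x) _) $
        Eq.trans (⋀-cong λ i → same _ t) $
        Eq.sym (sup-conical 𝕏 𝕏-complete (proj₂ (proj₂ (F-dense x))) _)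

      Φ-mono : ∀ x x′ → hom 𝕏 x x′ ≤ hom 𝕐 (Φ x) (Φ x′)
      Φ-mono x x′ with G′-dense (Φ x′)
      ... | I , t , inf = trans
        (⋀-greatest _ λ i → trans
          (⊑-post 𝕏 x (trans (proj₁ inf i) (≈⇒≤ (Φ-hom x′ (t i)))))
          (≈⇒≥ (Φ-hom x (t i))))
        (≈⇒≥ (inf-conical 𝕐 𝕐-complete inf (Φ x)))

      Φ-functor : QFunctor 𝕏 𝕐
      Φ-functor = record
        { func = record
          { to   = Φ
          ; cong = λ p → 𝕐-separated
              ( trans (≈⇒⊑ 𝕏 p) (Φ-mono _ _)
              , trans (≈⇒⊑ 𝕏 (Setoid.sym (objects 𝕏) p)) (Φ-mono _ _))
          }
        ; mono = Φ-mono
        }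

  module _ {S T : Setoid ℓ ℓ} (𝕏 𝕐 : QCategory 𝓠)
           (𝕏-separated : Separated 𝕏) (𝕏-complete : Complete 𝕏)
           (𝕐-separated : Separated 𝕐) (𝕐-complete : Complete 𝕐)
           (F : Func S (objects 𝕏)) (G : Func T (objects 𝕏))
           (F′ : Func S (objects 𝕐)) (G′ : Func T (objects 𝕐)) where

    same-homs⇒isomorphic : ⋁-Dense 𝕏 F → ⋀-Dense 𝕏 G →
                           ⋁-Dense 𝕐 F′ → ⋀-Dense 𝕐 G′ →
                           SameHoms 𝕏 𝕐 F G F′ G′ → Isomorphic 𝕏 𝕐
    same-homs⇒isomorphic F-dense G-dense F′-dense G′-dense same = record
      { to      = Φ.Φ-functor
      ; from    = Ψ.Φ-functor
      ; from-to = λ x → 𝕏-separated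
          ( ⋀-dense-⊑ 𝕏 G G-dense (λ t → ≈⇒≥ (ΨΦ x t))
          , ⋀-dense-⊑ 𝕏 G G-dense (λ t → ≈⇒≤ (ΨΦ x t)))
      ; to-from = λ y → 𝕐-separated
          ( ⋀-dense-⊑ 𝕐 G′ G′-dense (λ t → ≈⇒≥ (ΦΨ y t))
          , ⋀-dense-⊑ 𝕐 G′ G′-dense (λ t → ≈⇒≤ (ΦΨ y t)))
      }
      where
      module Φ = Comparison 𝕏 𝕐 F G F′ G′
        𝕏-complete 𝕐-separated 𝕐-complete F-dense G′-dense same
      module Ψ = Comparison 𝕐 𝕏 F′ G′ F G
        𝕐-complete 𝕏-separated 𝕏-complete F′-dense G-dense
        (λ s t → Eq.sym (same s t))

      ΨΦ : ∀ x t → hom 𝕏 (Ψ.Φ (Φ.Φ x)) (G ⟨$⟩ t) ≈ hom 𝕏 x (G ⟨$⟩ t)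
      ΨΦ x t = Eq.trans (Ψ.Φ-hom (Φ.Φ x) t) (Φ.Φ-hom x t)

      ΦΨ : ∀ y t → hom 𝕐 (Φ.Φ (Ψ.Φ y)) (G′ ⟨$⟩ t) ≈ hom 𝕐 y (G′ ⟨$⟩ t)
      ΦΨ y t = Eq.trans (Φ.Φ-hom (Ψ.Φ y) t) (Ψ.Φ-hom y t)

  -- Dense families pull back along an isomorphism, whose two functors P and R
  -- are fully faithful and adjoint on both sides (`homˡ`, `homʳ`).
  module Transport (𝕏 𝕐 : QCategory 𝓠) (iso : Isomorphic 𝕏 𝕐) where
    open Isomorphic iso using (from-to; to-from)
    open QFunctor (Isomorphic.to iso) using () renaming (func to P; mono to P-mono)
    open QFunctor (Isomorphic.from iso) using () renaming (func to R; mono to R-mono)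

    P-full : ∀ x x′ → hom 𝕏 x x′ ≈ hom 𝕐 (P ⟨$⟩ x) (P ⟨$⟩ x′)
    P-full x x′ = antisym (P-mono x x′) $
      trans (R-mono _ _) (≈⇒≤ (hom-cong 𝕏 (from-to x) (from-to x′)))

    homˡ : ∀ y x → hom 𝕏 (R ⟨$⟩ y) x ≈ hom 𝕐 y (P ⟨$⟩ x)
    homˡ y x = Eq.trans (P-full _ x)
      (hom-cong 𝕐 (to-from y) (Setoid.refl (objects 𝕐)))

    homʳ : ∀ x y → hom 𝕏 x (R ⟨$⟩ y) ≈ hom 𝕐 (P ⟨$⟩ x) y
    homʳ x y = Eq.trans (P-full x _)
      (hom-cong 𝕐 (Setoid.refl (objects 𝕐)) (to-from y))

    module _ {S : Setoid ℓ ℓ} (F′ : Func S (objects 𝕐)) where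

      pullback : Func S (objects 𝕏)
      pullback = record
        { to   = λ s → R ⟨$⟩ (F′ ⟨$⟩ s)
        ; cong = λ p → Func.cong R (Func.cong F′ p)
        }

      pullback-⋁-dense : ⋁-Dense 𝕐 F′ → ⋁-Dense 𝕏 pullback
      pullback-⋁-dense F′-dense x with F′-dense (P ⟨$⟩ x)
      ... | I , s , upper , least = I , s
        , (λ i → trans (upper i) (≈⇒≥ (homˡ _ x)))
        , λ z p → trans
            (least (P ⟨$⟩ z) λ i → trans (p i) (≈⇒≤ (homˡ _ z)))
            (≈⇒≥ (P-full x z))

      pullback-⋀-dense : ⋀-Dense 𝕐 F′ → ⋀-Dense 𝕏 pullback
      pullback-⋀-dense F′-dense x with F′-dense (P ⟨$⟩ x)
      ... | I , s , lower , greatest = I , s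
        , (λ i → trans (lower i) (≈⇒≥ (homʳ x _)))
        , λ z p → trans
            (greatest (P ⟨$⟩ z) λ i → trans (p i) (≈⇒≤ (homʳ z _)))
            (≈⇒≥ (P-full z x))

    pullback-hom : {S T : Setoid ℓ ℓ}
                   (F′ : Func S (objects 𝕐)) (G′ : Func T (objects 𝕐)) →
                   SameHoms 𝕏 𝕐 (pullback F′) (pullback G′) F′ G′
    pullback-hom F′ G′ s t = Eq.sym $
      Eq.trans (homˡ _ _) (hom-cong 𝕐 (Setoid.refl (objects 𝕐)) (to-from _))

  representation :
    {S T : Setoid ℓ ℓ} (𝕏 𝕐 : QCategory 𝓠) →
    Separated 𝕏 → Complete 𝕏 → Separated 𝕐 → Complete 𝕐 →
    (F′ : Func S (objects 𝕐)) (G′ : Func T (objects 𝕐)) →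
    ⋁-Dense 𝕐 F′ → ⋀-Dense 𝕐 G′ →
    Isomorphic 𝕏 𝕐 ⇔
      (Σ[ F ∈ Func S (objects 𝕏) ] Σ[ G ∈ Func T (objects 𝕏) ]
        ⋁-Dense 𝕏 F × ⋀-Dense 𝕏 G × SameHoms 𝕏 𝕐 F G F′ G′)
  representation 𝕏 𝕐 𝕏-sep 𝕏-com 𝕐-sep 𝕐-com F′ G′ F′-dense G′-dense = mk⇔
    (λ iso → let open Transport 𝕏 𝕐 iso in
        pullback F′ , pullback G′
      , pullback-⋁-dense F′ F′-dense , pullback-⋀-dense G′ G′-dense
      , pullback-hom F′ G′)
    (λ (F , G , F-dense , G-dense , same) →
      same-homs⇒isomorphic 𝕏 𝕐 𝕏-sep 𝕏-com 𝕐-sep 𝕐-com F G F′ G′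
        F-dense G-dense F′-dense G′-dense same)

  -- Presheaf categories

  module _ {𝔸 : QCategory 𝓠} where
    open QCategory (𝖯 𝔸) using (_⊑_)

    𝖯-intro : ∀ (μ ν : Presheaf 𝔸) {h} →
              (∀ x → (h ∘ μ ⟨ x ⟩) ≤ ν ⟨ x ⟩) → h ≤ hom (𝖯 𝔸) μ ν
    𝖯-intro μ ν p = ⋀-greatest _ λ x → ↙-intro (p x)

    𝖯-elim : ∀ (μ ν : Presheaf 𝔸) {h} → h ≤ hom (𝖯 𝔸) μ ν →
             ∀ x → (h ∘ μ ⟨ x ⟩) ≤ ν ⟨ x ⟩
    𝖯-elim μ ν p x = ↙-elim (trans p (⋀-lower _ x))

    𝖯-⊑-intro : ∀ (μ ν : Presheaf 𝔸) → (∀ x → μ ⟨ x ⟩ ≤ ν ⟨ x ⟩) → μ ⊑ ν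
    𝖯-⊑-intro μ ν p = 𝖯-intro μ ν λ x → trans (≈⇒≤ (identityˡ _)) (p x)

    𝖯-⊑-elim : ∀ (μ ν : Presheaf 𝔸) → μ ⊑ ν → ∀ x → μ ⟨ x ⟩ ≤ ν ⟨ x ⟩
    𝖯-⊑-elim μ ν p x = trans (≈⇒≥ (identityˡ _)) (𝖯-elim μ ν p x)

    𝖯-weighted : HasWeightedSups (𝖯 𝔸)
    𝖯-weighted {I} f w = σ , λ ν → antisym
      (⋀-greatest _ λ i → ↙-intro $ 𝖯-intro (f i) ν λ x →
        trans (assoc≤ _ _ _) $
        trans (∘-monoʳ _ (⋁-upper (λ j → w j ∘ f j ⟨ x ⟩) i)) $
        𝖯-elim σ ν refl x)
      (𝖯-intro σ ν λ x → trans (≈⇒≤ (∘-⋁ _ _)) $ ⋁-least _ λ i →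
        trans (assoc≥ _ _ _) $
        𝖯-elim (f i) ν (↙-elim (⋀-lower _ i)) x)
      where
      σ : Presheaf 𝔸
      σ = record
        { at     = λ x → ⋁ λ i → w i ∘ f i ⟨ x ⟩
        ; action = λ x x′ → trans (≈⇒≤ (⋁-∘ _ _)) $ ⋁-least _ λ i →
            trans (assoc≤ _ _ _) $
            trans (∘-monoʳ _ (action (f i) x x′)) (⋁-upper _ i)
        }

    -- The copower of the representable presheaf 𝔸(-, a) by u.
    copower : Obj 𝔸 → Carrier → Presheaf 𝔸
    copower a u = record
      { at     = λ x → u ∘ hom 𝔸 x a
      ; action = λ x x′ → trans (assoc≤ _ _ _) (∘-monoʳ u (comp 𝔸 x′ x a))
      }

    yoneda : ∀ a u (ν : Presheaf 𝔸) →
             hom (𝖯 𝔸) (copower a u) ν ≈ (ν ⟨ a ⟩ ↙ u)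
    yoneda a u ν = antisym
      (↙-intro $ trans (∘-monoʳ _ u≤) (𝖯-elim (copower a u) ν refl a))
      (𝖯-intro (copower a u) ν λ x → trans (assoc≥ _ _ _) $
        trans (∘-monoˡ _ (↙-eval _ u)) (action ν a x))
      where
      u≤ : u ≤ copower a u ⟨ a ⟩
      u≤ = trans (≈⇒≥ (identityʳ u)) (∘-monoʳ u (unit 𝔸 a))

    copower-cong : ∀ {a a′ u u′} → Setoid._≈_ (objects 𝔸) a a′ → u ≈ u′ →
                   Setoid._≈_ (objects (𝖯 𝔸)) (copower a u) (copower a′ u′)
    copower-cong p q x = ∙-cong q (hom-cong 𝔸 (Setoid.refl (objects 𝔸)) p)

  -- Closure operators on presheaves

  -- A closure operator on 𝖯 𝔸 that is enriched, i.e. a 𝓠-functor.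
  record Closure (𝔸 : QCategory 𝓠) : Set ℓ where
    field
      cl         : Presheaf 𝔸 → Presheaf 𝔸
      extensive  : ∀ μ x → μ ⟨ x ⟩ ≤ cl μ ⟨ x ⟩
      functorial : ∀ μ ν → hom (𝖯 𝔸) μ ν ≤ hom (𝖯 𝔸) (cl μ) (cl ν)
      idempotent : ∀ μ x → cl (cl μ) ⟨ x ⟩ ≤ cl μ ⟨ x ⟩

    IsFixed : Presheaf 𝔸 → Set ℓ
    IsFixed μ = Setoid._≈_ (objects (𝖯 𝔸)) (cl μ) μ

    Fixed : QCategory 𝓠
    Fixed = FullSub (𝖯 𝔸) IsFixed

    open QCategory Fixed using (_⊑_)

    ≤⇒fixed : ∀ μ → (∀ x → cl μ ⟨ x ⟩ ≤ μ ⟨ x ⟩) → IsFixed μ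
    ≤⇒fixed μ p x = antisym (p x) (extensive μ x)

    closed : Presheaf 𝔸 → Obj Fixed
    closed μ = cl μ , ≤⇒fixed (cl μ) (idempotent μ)

    -- cl is left adjoint to the inclusion of Fixed.
    reflect : ∀ μ (ν : Obj Fixed) →
              hom Fixed (closed μ) ν ≈ hom (𝖯 𝔸) μ (proj₁ ν)
    reflect μ (ν , ν-fixed) = antisym
      (⊑-pre (𝖯 𝔸) {μ} {cl μ} ν (𝖯-⊑-intro μ (cl μ) (extensive μ)))
      (trans (functorial μ ν)
        (≈⇒≤ (hom-cong (𝖯 𝔸) {cl μ} {cl μ} {cl ν} {ν} (λ x → Eq.refl) ν-fixed)))

    Fixed-separated : Separated Fixed
    Fixed-separated {μ , _} {ν , _} (p , q) x =
      antisym (𝖯-⊑-elim μ ν p x) (𝖯-⊑-elim ν μ q x)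

    Fixed-complete : Complete Fixed
    Fixed-complete = weighted⇒complete Fixed λ f w →
      let σ , σ-sup = 𝖯-weighted (λ i → proj₁ (f i)) w in
      closed σ , λ ν → Eq.trans (reflect σ ν) (σ-sup (proj₁ ν))

    closed-cong : ∀ {μ ν} → Setoid._≈_ (objects (𝖯 𝔸)) μ ν →
                  Setoid._≈_ (objects Fixed) (closed μ) (closed ν)
    closed-cong {μ} {ν} p = Fixed-separated {closed μ} {closed ν}
      ( trans (𝖯-⊑-intro μ ν (λ x → ≈⇒≤ (p x))) (functorial μ ν)
      , trans (𝖯-⊑-intro ν μ (λ x → ≈⇒≥ (p x))) (functorial ν μ))

    -- The closure of the copower of 𝔸(-, a) by u.
    generator : Func (objects 𝔸 ×ₛ setoid) (objects Fixed)
    generator = record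
      { to   = λ (a , u) → closed (copower a u)
      ; cong = λ {(a , u)} {(a′ , u′)} (p , q) →
          closed-cong {copower a u} {copower a′ u′} (copower-cong {𝔸} p q)
      }

    generator-hom : ∀ a u (ν : Obj Fixed) →
                    hom Fixed (generator ⟨$⟩ (a , u)) ν ≈ (proj₁ ν ⟨ a ⟩ ↙ u)
    generator-hom a u ν = Eq.trans (reflect (copower a u) ν) (yoneda a u (proj₁ ν))

    generator-⊑ : ∀ a u ν → (generator ⟨$⟩ (a , u)) ⊑ ν ⇔ u ≤ proj₁ ν ⟨ a ⟩
    generator-⊑ a u ν = mk⇔
      (λ p → trans (≈⇒≥ (identityˡ u)) (↙-elim (trans p (≈⇒≤ (generator-hom a u ν)))))
      (λ p → trans (↙-intro (trans (≈⇒≤ (identityˡ u)) p)) (≈⇒≥ (generator-hom a u ν)))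

    -- A fixed presheaf μ is the supremum of the generators at (a , μ(a)).
    generator-dense : ⋁-Dense Fixed generator
    generator-dense μ = Obj 𝔸 , (λ a → a , proj₁ μ ⟨ a ⟩)
      , (λ a → Equivalence.from (generator-⊑ a _ μ) refl)
      , λ ν p → 𝖯-⊑-intro (proj₁ μ) (proj₁ ν) λ a →
          Equivalence.to (generator-⊑ a _ ν) (p a)

    -- An infimum computed pointwise in 𝖯 𝔸 is also one among fixed presheaves.
    pointwise-inf : {I : Set ℓ} (f : I → Obj Fixed) (μ : Obj Fixed) →
      (∀ x → IsInf _≤_ (λ i → proj₁ (f i) ⟨ x ⟩) (proj₁ μ ⟨ x ⟩)) →
      IsInf _⊑_ f μ
    pointwise-inf f μ p =
        (λ i → 𝖯-⊑-intro (proj₁ μ) (proj₁ (f i)) λ x → proj₁ (p x) i)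
      , λ ν q → 𝖯-⊑-intro (proj₁ ν) (proj₁ μ) λ x →
          proj₂ (p x) _ λ i → 𝖯-⊑-elim (proj₁ ν) (proj₁ (f i)) (q i) x

  -- Anything equal to a meet is an infimum.
  IsInf-≈ : {I : Set ℓ} (f : I → Carrier) {s : Carrier} → ⋀ f ≈ s → IsInf _≤_ f s
  IsInf-≈ f p = (λ i → trans (≈⇒≥ p) (⋀-lower f i))
              , λ z q → trans (⋀-greatest f q) (≈⇒≤ p)

  -- The closure operators of a distributor

  module _ {𝔸 𝔹 : QCategory 𝓠} (φ : QDistributor 𝔸 𝔹) where

    private
      ↑-eval : ∀ μ a b → (Copresheaf.at (φ ↑ μ) b ∘ μ ⟨ a ⟩) ≤ φ ⟪ a , b ⟫
      ↑-eval μ a b = ↙-elim (⋀-lower _ a)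

      ↓-eval : ∀ κ a b → (Copresheaf.at κ b ∘ (φ ↓ κ) ⟨ a ⟩) ≤ φ ⟪ a , b ⟫
      ↓-eval κ a b = ↘-elim (⋀-lower _ b)

      ⁎-eval : ∀ μ a b → ((φ ⁎ μ) ⟨ b ⟩ ∘ φ ⟪ a , b ⟫) ≤ μ ⟨ a ⟩
      ⁎-eval μ a b = ↙-elim (⋀-lower _ a)

      ^*-unit : ∀ ν a b → (ν ⟨ b ⟩ ∘ φ ⟪ a , b ⟫) ≤ (φ ^* ν) ⟨ a ⟩
      ^*-unit ν a b = ⋁-upper _ b

    𝖬-closure : Closure 𝔸
    𝖬-closure = record
      { cl         = λ μ → φ ↓ φ ↑ μ
      ; extensive  = λ μ a → ⋀-greatest _ λ b → ↘-intro (↑-eval μ a b)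
      ; functorial = λ μ ν → 𝖯-intro (φ ↓ φ ↑ μ) (φ ↓ φ ↑ ν) λ a →
          ⋀-greatest _ λ b → ↘-intro $
          trans (assoc≥ _ _ _) $
          trans (∘-monoˡ _ (↑-action μ ν b)) (↓-eval (φ ↑ μ) a b)
      ; idempotent = λ μ a → ⋀-greatest _ λ b → trans (⋀-lower _ b) $
          ↘-mono (⋀-greatest _ λ a′ → ↙-intro (↓-eval (φ ↑ μ) a′ b)) refl
      }
      where
      -- φ ↑ is a contravariant functor into copresheaves.
      ↑-action : ∀ μ ν b →
        (Copresheaf.at (φ ↑ ν) b ∘ hom (𝖯 𝔸) μ ν) ≤ Copresheaf.at (φ ↑ μ) b
      ↑-action μ ν b = ⋀-greatest _ λ a → ↙-intro $
        trans (assoc≤ _ _ _) $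
        trans (∘-monoʳ _ (𝖯-elim μ ν refl a)) (↑-eval ν a b)

    𝖪-closure : Closure 𝔹
    𝖪-closure = record
      { cl         = λ ν → φ ⁎ φ ^* ν
      ; extensive  = λ ν b → ⋀-greatest _ λ a → ↙-intro (^*-unit ν a b)
      ; functorial = λ μ ν → 𝖯-intro (φ ⁎ φ ^* μ) (φ ⁎ φ ^* ν) λ b →
          ⋀-greatest _ λ a → ↙-intro $
          trans (assoc≤ _ _ _) $
          trans (∘-monoʳ _ (⁎-eval (φ ^* μ) a b)) (^*-action μ ν a)
      ; idempotent = λ ν b → ⋀-greatest _ λ a → trans (⋀-lower _ a) $
          ↙-mono (⋁-least _ λ b′ → ⁎-eval (φ ^* ν) a b′) refl
      }
      where
      -- φ ^* is a functor.
      ^*-action : ∀ μ ν a →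
        (hom (𝖯 𝔹) μ ν ∘ (φ ^* μ) ⟨ a ⟩) ≤ (φ ^* ν) ⟨ a ⟩
      ^*-action μ ν a = trans (≈⇒≤ (∘-⋁ _ _)) $ ⋁-least _ λ b →
        trans (assoc≥ _ _ _) $
        trans (∘-monoˡ _ (𝖯-elim μ ν refl b)) (^*-unit ν a b)

    -- The presheaf a ↦ v ↘ φ(a,b), up to equality φ ↓ applied to 𝔹(b,-) ∘ v.
    𝖬-cogenerator : Func (objects 𝔹 ×ₛ setoid) (objects (𝖬 φ))
    𝖬-cogenerator = record
      { to   = λ (b , v) → γ b v , γ-fixed b v
      ; cong = λ (p , q) a → antisym
          (γ-mono p (≈⇒≥ q) a)
          (γ-mono (Setoid.sym (objects 𝔹) p) (≈⇒≤ q) a)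
      }
      where
      γ : Obj 𝔹 → Carrier → Presheaf 𝔸
      γ b v = record
        { at     = λ a → v ↘ φ ⟪ a , b ⟫
        ; action = λ a a′ → ↘-intro $ trans (assoc≥ _ _ _) $
            trans (∘-monoˡ _ (↘-eval v _)) (actionʳ φ a a′ b)
        }

      γ-fixed : ∀ b v → Closure.IsFixed 𝖬-closure (γ b v)
      γ-fixed b v = Closure.≤⇒fixed 𝖬-closure (γ b v) λ a →
        trans (⋀-lower _ b) $
        ↘-mono (⋀-greatest _ λ a′ → ↙-intro (↘-eval v _)) refl

      γ-mono : ∀ {b b′ v v′} → Setoid._≈_ (objects 𝔹) b b′ → v′ ≤ v →
               ∀ a → γ b v ⟨ a ⟩ ≤ γ b′ v′ ⟨ a ⟩
      γ-mono {b} {b′} p q a = ↘-mono q $ trans (≈⇒≥ (identityˡ _)) $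
        trans (∘-monoˡ _ (≈⇒⊑ 𝔹 p)) (actionˡ φ a b b′)

    -- A fixed presheaf μ = φ ↓ φ ↑ μ is the meet over b of (φ ↑ μ)(b) ↘ φ(-,b).
    𝖬-cogenerator-dense : ⋀-Dense (𝖬 φ) 𝖬-cogenerator
    𝖬-cogenerator-dense (μ , μ-fixed) = Obj 𝔹 , x
      , Closure.pointwise-inf 𝖬-closure (λ b → 𝖬-cogenerator ⟨$⟩ x b) (μ , μ-fixed)
          λ a → IsInf-≈ _ (μ-fixed a)
      where
      x : Obj 𝔹 → Obj 𝔹 × Carrier
      x b = b , Copresheaf.at (φ ↑ μ) b

    -- The presheaf b ↦ u ↙ φ(a,b), up to equality φ ⁎ applied to u ↙ 𝔸(a,-).
    𝖪-cogenerator : Func (objects 𝔸 ×ₛ setoid) (objects (𝖪 φ))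
    𝖪-cogenerator = record
      { to   = λ (a , u) → γ a u , γ-fixed a u
      ; cong = λ (p , q) b → antisym
          (γ-mono p (≈⇒≤ q) b)
          (γ-mono (Setoid.sym (objects 𝔸) p) (≈⇒≥ q) b)
      }
      where
      γ : Obj 𝔸 → Carrier → Presheaf 𝔹
      γ a u = record
        { at     = λ b → u ↙ φ ⟪ a , b ⟫
        ; action = λ b b′ → ↙-intro $ trans (assoc≤ _ _ _) $
            trans (∘-monoʳ _ (actionˡ φ a b′ b)) (↙-eval u _)
        }

      γ-fixed : ∀ a u → Closure.IsFixed 𝖪-closure (γ a u)
      γ-fixed a u = Closure.≤⇒fixed 𝖪-closure (γ a u) λ b →
        trans (⋀-lower _ a) $
        ↙-mono (⋁-least _ λ b′ → ↙-eval u _) refl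

      γ-mono : ∀ {a a′ u u′} → Setoid._≈_ (objects 𝔸) a a′ → u ≤ u′ →
               ∀ b → γ a u ⟨ b ⟩ ≤ γ a′ u′ ⟨ b ⟩
      γ-mono {a} {a′} p q b = ↙-mono q $ trans (≈⇒≥ (identityʳ _)) $
        trans (∘-monoʳ _ (≈⇒⊑ 𝔸 p)) (actionʳ φ a′ a b)

    -- A fixed presheaf ν = φ ⁎ φ ^* ν is the meet over a of (φ ^* ν)(a) ↙ φ(a,-).
    𝖪-cogenerator-dense : ⋀-Dense (𝖪 φ) 𝖪-cogenerator
    𝖪-cogenerator-dense (ν , ν-fixed) = Obj 𝔸 , x
      , Closure.pointwise-inf 𝖪-closure (λ a → 𝖪-cogenerator ⟨$⟩ x a) (ν , ν-fixed)
          λ b → IsInf-≈ _ (ν-fixed b)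
      where
      x : Obj 𝔸 → Obj 𝔸 × Carrier
      x a = a , (φ ^* ν) ⟨ a ⟩

    𝖬-hom : ∀ a b u v →
      hom (𝖬 φ) (Closure.generator 𝖬-closure ⟨$⟩ (a , u)) (𝖬-cogenerator ⟨$⟩ (b , v))
        ≈ (v ↘ (φ ⟪ a , b ⟫ ↙ u))
    𝖬-hom a b u v = Eq.trans
      (Closure.generator-hom 𝖬-closure a u (𝖬-cogenerator ⟨$⟩ (b , v)))
      (↘-↙-assoc v _ u)

    𝖪-hom : ∀ a b u v →
      hom (𝖪 φ) (Closure.generator 𝖪-closure ⟨$⟩ (b , v)) (𝖪-cogenerator ⟨$⟩ (a , u))
        ≈ ((u ↙ φ ⟪ a , b ⟫) ↙ v)
    𝖪-hom a b u v =
      Closure.generator-hom 𝖪-closure b v (𝖪-cogenerator ⟨$⟩ (a , u))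

corollary7p9 :
  ∀ {ℓ : Level} (𝓠 : Quantale ℓ) (𝔸 𝔹 : QCategory 𝓠) (φ : QDistributor 𝔸 𝔹)
    (𝕏 : QCategory 𝓠) → Separated 𝕏 → Complete 𝕏 →
  let open Quantale 𝓠
      open QCategory using (objects)
      open QCategory using (hom)
      open QDistributor using (at)
  in
  (Isomorphic 𝕏 (𝖬 φ) ⇔
    (Σ[ F ∈ Func (objects 𝔸 ×ₛ setoid) (objects 𝕏) ]
     Σ[ G ∈ Func (objects 𝔹 ×ₛ setoid) (objects 𝕏) ]
       ⋁-Dense 𝕏 F × ⋀-Dense 𝕏 G ×
       (∀ a b u v →
         (v ↘ (at φ a b ↙ u)) ≈ hom 𝕏 (F ⟨$⟩ (a , u)) (G ⟨$⟩ (b , v)))))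
  ×
  (Isomorphic 𝕏 (𝖪 φ) ⇔
    (Σ[ F ∈ Func (objects 𝔹 ×ₛ setoid) (objects 𝕏) ]
     Σ[ G ∈ Func (objects 𝔸 ×ₛ setoid) (objects 𝕏) ]
       ⋁-Dense 𝕏 F × ⋀-Dense 𝕏 G ×
       (∀ a b u v →
         ((u ↙ at φ a b) ↙ v) ≈ hom 𝕏 (F ⟨$⟩ (b , v)) (G ⟨$⟩ (a , u)))))
corollary7p9 𝓠 𝔸 𝔹 φ 𝕏 separated complete =
    mk⇔
      (λ iso → let F , G , dF , dG , same = Equivalence.to 𝖬-representation iso in
        F , G , dF , dG , λ a b u v →
          Eq.trans (Eq.sym (𝖬-hom φ a b u v)) (same (a , u) (b , v)))
      (λ (F , G , dF , dG , same) → Equivalence.from 𝖬-representation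
        (F , G , dF , dG , λ (a , u) (b , v) →
          Eq.trans (𝖬-hom φ a b u v) (same a b u v)))
  , mk⇔
      (λ iso → let F , G , dF , dG , same = Equivalence.to 𝖪-representation iso in
        F , G , dF , dG , λ a b u v →
          Eq.trans (Eq.sym (𝖪-hom φ a b u v)) (same (b , v) (a , u)))
      (λ (F , G , dF , dG , same) → Equivalence.from 𝖪-representation
        (F , G , dF , dG , λ (b , v) (a , u) →
          Eq.trans (𝖪-hom φ a b u v) (same a b u v)))
  where
  open Quantale 𝓠 using (module Eq)
  module M = Closure (𝖬-closure φ)
  module K = Closure (𝖪-closure φ)

  𝖬-representation = representation 𝕏 (𝖬 φ) separated complete
    (λ {x} {y} → M.Fixed-separated {x} {y}) M.Fixed-complete
    M.generator (𝖬-cogenerator φ) M.generator-dense (𝖬-cogenerator-dense φ)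

  𝖪-representation = representation 𝕏 (𝖪 φ) separated complete
    (λ {x} {y} → K.Fixed-separated {x} {y}) K.Fixed-complete
    K.generator (𝖪-cogenerator φ) K.generator-dense (𝖪-cogenerator-dense φ)
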